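{- Let $N\ge 3$. Then $O\!N\!C_N\subseteq\mathfrak{A}_N$, and for all $x,y\in O\!N\!C_N$ one has $x\le_{\mathbf 3}y$ if and only if $x\le_{\mathbf 2}y$; i.e. the poset $(O\!N\!C_N,\le_{\mathbf 3})$ is an induced subposet of $(N\!C_N,\le_{\mathbf 2})$.
   Context: $\mathfrak{S}_N$ is the symmetric group on $[N]$, $\mathfrak{A}_N$ the alternating group; products are composed right to left. For $x\in\mathfrak{S}_N$, $\ell_{\mathbf 2}(x)$ is the minimal number of transpositions with product $x$ and $x\le_{\mathbf 2}y$ iff $\ell_{\mathbf 2}(y)=\ell_{\mathbf 2}(x)+\ell_{\mathbf 2}(x^{ -1}y)$. For $x\in\mathfrak{A}_N$, $\ell_{\mathbf 3}(x)$ is the minimal number of $3$-cycles with product $x$ and $x\le_{\mathbf 3}y$ iff $\ell_{\mathbf 3}(y)=\ell_{\mathbf 3}(x)+\ell_{\mathbf 3}(x^{ -1}y)$. Let $c=(1\;2\;\ldots\;N)$. $N\!C_N=\{x\in\mathfrak S_N: x\le_{\mathbf 2}c\}$ (the noncrossing partitions; each cycle of such $x$, including fixed points, can be written as an increasing cycle $(u_1<u_2<\cdots<u_q)$). $O\!N\!C_N$ is the set of $x\in N\!C_N$ all of whose cycles $(u_1<\cdots<u_q)$ satisfy: $q$ is odd and $u_{j+1}-u_j$ is odd for all $j\in[q-1]$. -}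

module Defs where

open import Data.Nat using (ℕ; zero; suc; _+_; _*_; _∸_; _≤_; _<_)
open import Data.Fin using (Fin; zero; suc; toℕ; fromℕ; inject₁)
open import Data.Fin.Permutation public
  using (Permutation′; _⟨$⟩ʳ_; _⟨$⟩ˡ_; _≈_; id; flip; _∘ₚ_; transpose; permutation)
open import Data.List using (List; []; _∷_; length; foldr)
open import Data.List.Relation.Unary.All using (All)
open import Data.Product using (Σ; ∃; ∃-syntax; _×_; _,_)
open import Relation.Binary.PropositionalEquality using (_≡_; _≢_; refl; cong)

-- Permutations of [N] = Fin N (0-indexed: element i of Fin N is i+1).

Perm : ℕ → Set
Perm N = Permutation′ N

-- Product composed right to left: (x · y)(i) = x (y i).
infixl 7 _·_
_·_ : ∀ {N} → Perm N → Perm N → Perm N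
x · y = y ∘ₚ x

_⁻¹ : ∀ {N} → Perm N → Perm N
x ⁻¹ = flip x

prod : ∀ {N} → List (Perm N) → Perm N
prod = foldr _·_ id

IsTransposition : ∀ {N} → Perm N → Set
IsTransposition {N} t = ∃[ i ] ∃[ j ] (i ≢ j × t ≈ transpose i j)

IsThreeCycle : ∀ {N} → Perm N → Set
IsThreeCycle {N} t = ∃[ i ] ∃[ j ] ∃[ k ]
  (i ≢ j × j ≢ k × i ≢ k ×
   (t ⟨$⟩ʳ i ≡ j) × (t ⟨$⟩ʳ j ≡ k) × (t ⟨$⟩ʳ k ≡ i) ×
   (∀ l → l ≢ i → l ≢ j → l ≢ k → t ⟨$⟩ʳ l ≡ l))

ProdOf : ∀ {N} → (Perm N → Set) → ℕ → Perm N → Set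
ProdOf {N} S k x = Σ (List (Perm N)) λ ts → length ts ≡ k × All S ts × prod ts ≈ x

LengthIs : ∀ {N} → (Perm N → Set) → Perm N → ℕ → Set
LengthIs S x k = ProdOf S k x × (∀ m → ProdOf S m x → k ≤ m)

AbsLe : ∀ {N} → (Perm N → Set) → Perm N → Perm N → Set
AbsLe S x y = ∃[ a ] ∃[ b ] ∃[ c ]
  (LengthIs S x a × LengthIs S (x ⁻¹ · y) b × LengthIs S y c × c ≡ a + b)

ℓ₂-is : ∀ {N} → Perm N → ℕ → Set
ℓ₂-is = LengthIs IsTransposition

ℓ₃-is : ∀ {N} → Perm N → ℕ → Set
ℓ₃-is = LengthIs IsThreeCycle

_≤₂_ : ∀ {N} → Perm N → Perm N → Set
_≤₂_ = AbsLe IsTransposition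

_≤₃_ : ∀ {N} → Perm N → Perm N → Set
_≤₃_ = AbsLe IsThreeCycle

InAlt : ∀ {N} → Perm N → Set
InAlt x = ∃[ k ] ProdOf IsTransposition (2 * k) x

-- The long cycle c = (1 2 … N), i.e. i ↦ i+1 (mod N) on Fin N.

cyc : ∀ {n} → Fin (suc n) → Fin (suc n)
cyc {zero} zero = zero
cyc {suc n} zero = suc zero
cyc {suc n} (suc i) with cyc {n} i
... | zero = zero
... | suc j = suc (suc j)

cyc⁻ : ∀ {n} → Fin (suc n) → Fin (suc n)
cyc⁻ {n} zero = fromℕ n
cyc⁻ (suc i) = inject₁ i

cyc-inject₁ : ∀ {n} (i : Fin n) → cyc (inject₁ i) ≡ suc i
cyc-inject₁ {suc n} zero = refl
cyc-inject₁ {suc n} (suc i) with cyc {n} (inject₁ i) | cyc-inject₁ i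
... | .(suc i) | refl = refl

cyc-fromℕ : ∀ n → cyc (fromℕ n) ≡ zero
cyc-fromℕ zero = refl
cyc-fromℕ (suc n) with cyc {n} (fromℕ n) | cyc-fromℕ n
... | .zero | refl = refl

cyc-cyc⁻ : ∀ {n} (i : Fin (suc n)) → cyc (cyc⁻ i) ≡ i
cyc-cyc⁻ {n} zero = cyc-fromℕ n
cyc-cyc⁻ (suc i) = cyc-inject₁ i

cyc⁻-cyc : ∀ {n} (i : Fin (suc n)) → cyc⁻ (cyc i) ≡ i
cyc⁻-cyc {zero} zero = refl
cyc⁻-cyc {suc n} zero = refl
cyc⁻-cyc {suc n} (suc i) with cyc {n} i | cyc⁻-cyc {n} i
... | zero | eq = cong suc eq
... | suc j | eq = cong suc eq

longCycle : ∀ N → Perm N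
longCycle zero = id
longCycle (suc n) = permutation cyc cyc⁻ cyc-cyc⁻ cyc⁻-cyc

NC : ∀ {N} → Perm N → Set
NC {N} x = x ≤₂ longCycle N

iter : ∀ {N} → Perm N → ℕ → Fin N → Fin N
iter x zero i = i
iter x (suc k) i = x ⟨$⟩ʳ iter x k i

Odd : ℕ → Set
Odd n = ∃[ k ] n ≡ suc (2 * k)

CycleLength : ∀ {N} → Perm N → Fin N → ℕ → Set
CycleLength x i q = 1 ≤ q × iter x q i ≡ i × (∀ m → 1 ≤ m → m < q → iter x m i ≢ i)

-- ONC_N: x ∈ NC_N, every cycle has odd length, and in every cycle
-- (u₁ < … < u_q) (so x(u_j) = u_{j+1} for j < q, i.e. exactly for the
-- elements u with u < x(u)) the gaps u_{j+1} − u_j are odd.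
ONC : ∀ {N} → Perm N → Set
ONC x = NC x
  × (∀ i q → CycleLength x i q → Odd q)
  × (∀ i → toℕ i < toℕ (x ⟨$⟩ʳ i) → Odd (toℕ (x ⟨$⟩ʳ i) ∸ toℕ i))

{-# OPTIONS --safe #-}
module Submission where

-- If all cycles of x are odd then ℓ₃ x = ℓ₂ x / 2, and ℓ₂ ≤ 2 ℓ₃ always, so on
-- ONC the relation ≤₃ implies ≤₂. For the converse one needs z = x⁻¹ y to have
-- odd cycles when x ≤₂ y. For increasing cycles the ONC condition is equivalent
-- to the local parity rule "u and x(u) have opposite parity iff u < x(u)". Since
-- z(u) lies in the y-block of u, and y(u) is the next element of that block, the
-- rule for y at u and for x at z(u) (where x(z(u)) = y(u)) yields the rule for z
-- at u. An increasing z obeying the rule is peeled by 3-cycles: the least moved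
-- point u satisfies u < z(u) < z²(u), and removing u and z(u) from their cycle
-- lowers ℓ₂ by 2 and preserves the rule.

open import Defs
open import Data.Nat using (ℕ; zero; suc; _+_; _*_; _∸_; _≤_; _<_; z≤n; s≤s)
import Data.Nat.Properties as ℕ
import Data.Fin as F
open import Data.Fin using (Fin; zero; suc; toℕ)
open import Data.Fin.Properties using (_≟_; _<?_; _≤?_; all?; suc-injective; toℕ-injective; toℕ≤pred[n]; toℕ<n; toℕ-inject; toℕ-fromℕ<; ¬∀⟶∃¬-smallest)
open import Data.Fin.Permutation using (inverseˡ; inverseʳ; remove; lift₀; lift₀-remove; lift₀-transpose)
open import Data.Bool using (Bool; true; not)
import Data.Bool.Properties as Bool
open import Data.List using (List; []; _∷_; length; map)
open import Data.List.Properties using (length-map; ∷-injective; ≡-dec)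
open import Data.List.Relation.Unary.All using (All; []; _∷_)
open import Data.Product using (Σ; ∃-syntax; _×_; _,_; proj₁; proj₂)
open import Data.Sum using (_⊎_; inj₁; inj₂)
open import Function using (_∘_)
open import Function.Bundles using (_⇔_; mk⇔)
open import Relation.Binary.Definitions using (Tri; tri<; tri≈; tri>)
open import Relation.Binary.PropositionalEquality
open import Relation.Nullary using (Dec; yes; no; does; contradiction; _×-dec_)
open import Relation.Nullary.Decidable using (does-⇔)

private
  variable
    n : ℕ

-- Transpositions.

⟨$⟩ʳ-injective : (x : Perm n) → ∀ {a b} → x ⟨$⟩ʳ a ≡ x ⟨$⟩ʳ b → a ≡ b
⟨$⟩ʳ-injective x eq = trans (sym (inverseˡ x)) (trans (cong (x ⟨$⟩ˡ_) eq) (inverseˡ x))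

-- τ, strip and ℓ are opaque because unification otherwise unfolds the
-- permutation records, which makes type checking impractically slow.
opaque
  τ : Fin n → Fin n → Perm n
  τ = transpose

data TransposeView (i j k : Fin n) : Fin n → Set where
  at-i : k ≡ i → TransposeView i j k j
  at-j : k ≢ i → k ≡ j → TransposeView i j k i
  off  : k ≢ i → k ≢ j → TransposeView i j k k

opaque
  unfolding τ

  τ-≈ : ∀ (i j : Fin n) → τ i j ≈ transpose i j
  τ-≈ i j k = refl

  transposeView : ∀ (i j k : Fin n) → TransposeView i j k (τ i j ⟨$⟩ʳ k)
  transposeView i j k with k ≟ i
  ... | yes k≡i = at-i k≡i
  ... | no k≢i with k ≟ j
  ...   | yes k≡j = at-j k≢i k≡j
  ...   | no k≢j  = off k≢i k≢j

  τ-suc : ∀ (i j k : Fin n) → τ (suc i) (suc j) ⟨$⟩ʳ suc k ≡ suc (τ i j ⟨$⟩ʳ k)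
  τ-suc i j k = lift₀-transpose i j (suc k)

τ-i : ∀ (i j : Fin n) → τ i j ⟨$⟩ʳ i ≡ j
τ-i i j with τ i j ⟨$⟩ʳ i | transposeView i j i
... | _ | at-i _     = refl
... | _ | at-j i≢i _ = contradiction refl i≢i
... | _ | off i≢i _  = contradiction refl i≢i

τ-j : ∀ (i j : Fin n) → τ i j ⟨$⟩ʳ j ≡ i
τ-j i j with τ i j ⟨$⟩ʳ j | transposeView i j j
... | _ | at-i j≡i   = j≡i
... | _ | at-j _ _   = refl
... | _ | off _ j≢j  = contradiction refl j≢j

τ-off : ∀ {i j k : Fin n} → k ≢ i → k ≢ j → τ i j ⟨$⟩ʳ k ≡ k
τ-off {i = i} {j} {k} k≢i k≢j with τ i j ⟨$⟩ʳ k | transposeView i j k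
... | _ | at-i k≡i   = contradiction k≡i k≢i
... | _ | at-j _ k≡j = contradiction k≡j k≢j
... | _ | off _ _    = refl

τ-involutive : ∀ (i j k : Fin n) →
  τ i j ⟨$⟩ʳ (τ i j ⟨$⟩ʳ k) ≡ k
τ-involutive i j k with τ i j ⟨$⟩ʳ k | transposeView i j k
... | _ | at-i refl     = τ-j i j
... | _ | at-j _ refl   = τ-i i j
... | _ | off k≢i k≢j   = τ-off k≢i k≢j

τ-sym : ∀ (i j : Fin n) → τ i j ≈ τ j i
τ-sym i j k with τ i j ⟨$⟩ʳ k | transposeView i j k
... | _ | at-i refl     = sym (τ-j j i)
... | _ | at-j _ refl   = sym (τ-i j i)
... | _ | off k≢i k≢j   = sym (τ-off k≢j k≢i)

τ-diagonal : ∀ (i k : Fin n) → τ i i ⟨$⟩ʳ k ≡ k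
τ-diagonal i k with τ i i ⟨$⟩ʳ k | transposeView i i k
... | _ | at-i refl   = refl
... | _ | at-j _ refl = refl
... | _ | off _ _     = refl

-- Conjugation of a transposition, written without inverses; it moves transpositions from one side
-- of `x` to the other.
τ-conj : ∀ (x : Perm n) i j k →
  x ⟨$⟩ʳ (τ i j ⟨$⟩ʳ k) ≡ τ (x ⟨$⟩ʳ i) (x ⟨$⟩ʳ j) ⟨$⟩ʳ (x ⟨$⟩ʳ k)
τ-conj x i j k with τ i j ⟨$⟩ʳ k | transposeView i j k
... | _ | at-i refl     = sym (τ-i (x ⟨$⟩ʳ i) (x ⟨$⟩ʳ j))
... | _ | at-j _ refl   = sym (τ-j (x ⟨$⟩ʳ i) (x ⟨$⟩ʳ j))
... | _ | off k≢i k≢j   = sym (τ-off (k≢i ∘ ⟨$⟩ʳ-injective x) (k≢j ∘ ⟨$⟩ʳ-injective x))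

-- Invariant labellings.

-- Labels are lists of bits because splitting a block refines its label by
-- one more bit.
Label : Set
Label = List Bool

Invariant : (Fin n → Label) → Perm n → Set
Invariant f x = ∀ k → f (x ⟨$⟩ʳ k) ≡ f k

τ-invariant : ∀ (f : Fin n → Label) {i j} → f i ≡ f j → Invariant f (τ i j)
τ-invariant f {i} {j} fi≡fj k with τ i j ⟨$⟩ʳ k | transposeView i j k
... | _ | at-i refl   = sym fi≡fj
... | _ | at-j _ refl = fi≡fj
... | _ | off _ _     = refl

-- Length by deleting points.

-- strip x deletes 0 from its cycle: x = (0 x(0)) · lift₀ (strip x).
opaque
  strip : Perm (suc n) → Perm n
  strip x = remove zero (τ zero (x ⟨$⟩ʳ zero) · x)

  suc-strip : ∀ (x : Perm (suc n)) k →
    suc (strip x ⟨$⟩ʳ k) ≡ τ zero (x ⟨$⟩ʳ zero) ⟨$⟩ʳ (x ⟨$⟩ʳ suc k)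
  suc-strip x k = lift₀-remove (τ zero (x ⟨$⟩ʳ zero) · x)
    (τ-j zero (x ⟨$⟩ʳ zero)) (suc k)

strip-suc : ∀ (x : Perm (suc n)) {a b} → x ⟨$⟩ʳ suc a ≡ suc b → strip x ⟨$⟩ʳ a ≡ b
strip-suc x {a} {b} eq = suc-injective (trans (suc-strip x a)
  (trans (cong (τ zero (x ⟨$⟩ʳ zero) ⟨$⟩ʳ_) eq)
         (τ-off {i = zero} (λ ()) (λ b≡x0 → 0≢s (⟨$⟩ʳ-injective x (trans (sym b≡x0) (sym eq)))))))
  where
  0≢s : zero ≢ suc a
  0≢s ()

strip-zero : ∀ (x : Perm (suc n)) {a c} →
  x ⟨$⟩ʳ suc a ≡ zero → x ⟨$⟩ʳ zero ≡ suc c → strip x ⟨$⟩ʳ a ≡ c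
strip-zero x {a} eq eq₀ = suc-injective (trans (suc-strip x a)
  (trans (cong (τ zero (x ⟨$⟩ʳ zero) ⟨$⟩ʳ_) eq)
         (trans (τ-i zero (x ⟨$⟩ʳ zero)) eq₀)))

strip-unique : ∀ (x : Perm (suc n)) (p : Perm n) →
  (∀ k → τ zero (x ⟨$⟩ʳ zero) ⟨$⟩ʳ (x ⟨$⟩ʳ suc k) ≡ suc (p ⟨$⟩ʳ k)) → strip x ≈ p
strip-unique x p h k = suc-injective (trans (suc-strip x k) (h k))

strip-cong : ∀ (x y : Perm (suc n)) → x ≈ y → strip x ≈ strip y
strip-cong x y x≈y = strip-unique x (strip y) λ k →
  trans (cong₂ (λ a b → τ zero a ⟨$⟩ʳ b) (x≈y zero) (x≈y (suc k))) (sym (suc-strip y k))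

strip-invariant : ∀ (f : Fin (suc n) → Label) x → Invariant f x → Invariant (f ∘ suc) (strip x)
strip-invariant f x inv k = begin
  f (suc (strip x ⟨$⟩ʳ k))                                      ≡⟨ cong f (suc-strip x k) ⟩
  f (τ zero (x ⟨$⟩ʳ zero) ⟨$⟩ʳ (x ⟨$⟩ʳ suc k))          ≡⟨ τ-invariant f (sym (inv zero)) _ ⟩
  f (x ⟨$⟩ʳ suc k)                                              ≡⟨ inv (suc k) ⟩
  f (suc k)                                                     ∎
  where open ≡-Reasoning

isSuc : Fin n → ℕ
isSuc zero    = 0
isSuc (suc _) = 1

opaque
  -- A cycle of length q counts q - 1 times, since its last remaining point is fixed when deleted.
  -- So this is `n` minus the number of cycles, in a form suited to induction on `n`.
  ℓ : Perm n → ℕ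
  ℓ {zero}  x = 0
  ℓ {suc n} x = isSuc (x ⟨$⟩ʳ zero) + ℓ (strip x)

  ℓ-zero : (x : Perm 0) → ℓ x ≡ 0
  ℓ-zero x = refl

  ℓ-suc : (x : Perm (suc n)) → ℓ x ≡ isSuc (x ⟨$⟩ʳ zero) + ℓ (strip x)
  ℓ-suc x = refl

  ℓ-cong : ∀ (x y : Perm n) → x ≈ y → ℓ x ≡ ℓ y
  ℓ-cong {zero}  x y x≈y = refl
  ℓ-cong {suc n} x y x≈y =
    cong₂ _+_ (cong isSuc (x≈y zero)) (ℓ-cong (strip x) (strip y) (strip-cong x y x≈y))

ℓ-id : ∀ n → ℓ (id {n}) ≡ 0
ℓ-id zero    = ℓ-zero id
ℓ-id (suc n) = trans (ℓ-suc id) (trans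
  (ℓ-cong (strip id) id (strip-unique id id λ k → τ-off {i = zero} {zero} (λ ()) (λ ()))) (ℓ-id n))

ℓ-fix : ∀ (x : Perm (suc n)) → x ⟨$⟩ʳ zero ≡ zero → ℓ x ≡ ℓ (strip x)
ℓ-fix x eq = trans (ℓ-suc x) (cong (λ v → isSuc v + ℓ (strip x)) eq)

ℓ-move : ∀ (x : Perm (suc n)) {c} → x ⟨$⟩ʳ zero ≡ suc c → ℓ x ≡ suc (ℓ (strip x))
ℓ-move x eq = trans (ℓ-suc x) (cong (λ v → isSuc v + ℓ (strip x)) eq)

-- Effect of a transposition on the length.

-- ℓ changes by ±1 under a transposition. It drops only if i and j lie in the
-- same cycle, expressed as: no invariant labelling separates them.
data Step (x : Perm n) (i j : Fin n) : Set where
  up   : ℓ (τ i j · x) ≡ suc (ℓ x) → x ⟨$⟩ʳ i ≢ j → x ⟨$⟩ʳ j ≢ i → Step x i j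
  down : ℓ x ≡ suc (ℓ (τ i j · x)) → (∀ f → Invariant f x → f i ≡ f j) → Step x i j

Step-sym : ∀ {x : Perm n} {i j} → Step x i j → Step x j i
Step-sym {x = x} {i} {j} s with ℓ-cong (τ i j · x) (τ j i · x) (λ k → τ-sym i j (x ⟨$⟩ʳ k))
Step-sym (up eq p q) | e = up (trans (sym e) eq) q p
Step-sym (down eq p) | e = down (trans eq (cong suc e)) (λ f inv → sym (p f inv))

-- If 0 is fixed, the transposition inserts 0 into the cycle of `suc b`. If x(0) = `suc b`, it cuts
-- 0 off as a fixed point. Otherwise x(0) = `suc c` is unchanged, and deleting 0 leaves `τ c b`
-- acting on `strip x`, to which `rec` applies.
step₀ : ∀ (x : Perm (suc n)) b → (∀ c → c ≢ b → Step (strip x) c b) → Step x zero (suc b)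
step₀ {n} x b rec = go (x ⟨$⟩ʳ zero) refl
  where
  t = τ zero (suc b)

  go : ∀ v → x ⟨$⟩ʳ zero ≡ v → Step x zero (suc b)
  go zero eq = up
    (trans (ℓ-move (t · x) tx0) (cong suc (trans (ℓ-cong _ (strip x) same) (sym (ℓ-fix x eq)))))
    (λ e → contradiction (trans (sym eq) e) (λ ()))
    (λ e → contradiction (⟨$⟩ʳ-injective x (trans e (sym eq))) (λ ()))
    where
    tx0 : (t · x) ⟨$⟩ʳ zero ≡ suc b
    tx0 = trans (cong (t ⟨$⟩ʳ_) eq) (τ-i zero (suc b))
    same : strip (t · x) ≈ strip x
    same = strip-unique (t · x) (strip x) λ k → begin
      τ zero ((t · x) ⟨$⟩ʳ zero) ⟨$⟩ʳ (t ⟨$⟩ʳ (x ⟨$⟩ʳ suc k))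
        ≡⟨ cong (λ v → τ zero v ⟨$⟩ʳ (t ⟨$⟩ʳ (x ⟨$⟩ʳ suc k))) tx0 ⟩
      t ⟨$⟩ʳ (t ⟨$⟩ʳ (x ⟨$⟩ʳ suc k))
        ≡⟨ τ-involutive zero (suc b) _ ⟩
      x ⟨$⟩ʳ suc k
        ≡⟨ τ-diagonal zero _ ⟨
      τ zero zero ⟨$⟩ʳ (x ⟨$⟩ʳ suc k)
        ≡⟨ cong (λ v → τ zero v ⟨$⟩ʳ (x ⟨$⟩ʳ suc k)) eq ⟨
      τ zero (x ⟨$⟩ʳ zero) ⟨$⟩ʳ (x ⟨$⟩ʳ suc k)
        ≡⟨ suc-strip x k ⟨
      suc (strip x ⟨$⟩ʳ k) ∎
      where open ≡-Reasoning
  go (suc c) eq with c ≟ b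
  ... | yes refl = down
    (trans (ℓ-move x eq) (cong suc (trans (ℓ-cong _ (strip (t · x)) same) (sym (ℓ-fix (t · x) tx0)))))
    (λ f inv → trans (sym (inv zero)) (cong f eq))
    where
    tx0 : (t · x) ⟨$⟩ʳ zero ≡ zero
    tx0 = trans (cong (t ⟨$⟩ʳ_) eq) (τ-j zero (suc c))
    same : strip x ≈ strip (t · x)
    same k = sym (strip-suc (t · x) (begin
      t ⟨$⟩ʳ (x ⟨$⟩ʳ suc k)
        ≡⟨ cong (λ v → τ zero v ⟨$⟩ʳ (x ⟨$⟩ʳ suc k)) eq ⟨
      τ zero (x ⟨$⟩ʳ zero) ⟨$⟩ʳ (x ⟨$⟩ʳ suc k)
        ≡⟨ suc-strip x k ⟨
      suc (strip x ⟨$⟩ʳ k) ∎))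
      where open ≡-Reasoning
  ... | no c≢b = lemma (rec c c≢b)
    where
    tx0 : (t · x) ⟨$⟩ʳ zero ≡ suc c
    tx0 = trans (cong (t ⟨$⟩ʳ_) eq) (τ-off {i = zero} (λ ()) (c≢b ∘ suc-injective))
    u = τ zero (suc c)
    -- Conjugation by `u` sends 0 to `suc c` and fixes `suc b`, so `u · t` acts as
    -- `τ (suc c) (suc b) · u`.
    same : strip (t · x) ≈ τ c b · strip x
    same = strip-unique (t · x) (τ c b · strip x) λ k → begin
      τ zero ((t · x) ⟨$⟩ʳ zero) ⟨$⟩ʳ (t ⟨$⟩ʳ (x ⟨$⟩ʳ suc k))
        ≡⟨ cong (λ v → τ zero v ⟨$⟩ʳ (t ⟨$⟩ʳ (x ⟨$⟩ʳ suc k))) tx0 ⟩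
      u ⟨$⟩ʳ (t ⟨$⟩ʳ (x ⟨$⟩ʳ suc k))
        ≡⟨ τ-conj u zero (suc b) _ ⟩
      τ (u ⟨$⟩ʳ zero) (u ⟨$⟩ʳ suc b) ⟨$⟩ʳ (u ⟨$⟩ʳ (x ⟨$⟩ʳ suc k))
        ≡⟨ cong₂ (λ v w → τ v w ⟨$⟩ʳ (u ⟨$⟩ʳ (x ⟨$⟩ʳ suc k)))
             (τ-i zero (suc c)) (τ-off {i = zero} (λ ()) (c≢b ∘ sym ∘ suc-injective)) ⟩
      τ (suc c) (suc b) ⟨$⟩ʳ (u ⟨$⟩ʳ (x ⟨$⟩ʳ suc k))
        ≡⟨ cong (λ v → τ (suc c) (suc b) ⟨$⟩ʳ (τ zero v ⟨$⟩ʳ (x ⟨$⟩ʳ suc k))) eq ⟨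
      τ (suc c) (suc b) ⟨$⟩ʳ (τ zero (x ⟨$⟩ʳ zero) ⟨$⟩ʳ (x ⟨$⟩ʳ suc k))
        ≡⟨ cong (τ (suc c) (suc b) ⟨$⟩ʳ_) (suc-strip x k) ⟨
      τ (suc c) (suc b) ⟨$⟩ʳ suc (strip x ⟨$⟩ʳ k)
        ≡⟨ τ-suc c b (strip x ⟨$⟩ʳ k) ⟩
      suc (τ c b ⟨$⟩ʳ (strip x ⟨$⟩ʳ k)) ∎
      where open ≡-Reasoning
    ℓtx : ℓ (t · x) ≡ suc (ℓ (τ c b · strip x))
    ℓtx = trans (ℓ-move (t · x) tx0) (cong suc (ℓ-cong (strip (t · x)) (τ c b · strip x) same))
    lemma : Step (strip x) c b → Step x zero (suc b)
    lemma (up e _ q) = up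
      (trans ℓtx (cong suc (trans e (sym (ℓ-move x eq)))))
      (λ e′ → c≢b (suc-injective (trans (sym eq) e′)))
      (λ e′ → q (strip-zero x e′ eq))
    lemma (down e p) = down
      (trans (ℓ-move x eq) (cong suc (trans e (sym ℓtx))))
      (λ f inv → trans (sym (inv zero)) (trans (cong f eq) (p (f ∘ suc) (strip-invariant f x inv))))

step : ∀ (x : Perm n) {i j} → i ≢ j → Step x i j
step x {zero}  {zero}  i≢j = contradiction refl i≢j
step x {zero}  {suc b} i≢j = step₀ x b (λ c c≢b → step (strip x) c≢b)
step x {suc a} {zero}  i≢j = Step-sym (step₀ x a (λ c c≢a → step (strip x) c≢a))
step x {suc a} {suc b} i≢j = lemma (step (strip x) (i≢j ∘ cong suc))
  where
  t = τ (suc a) (suc b)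
  isSuc-t : ∀ v → isSuc (t ⟨$⟩ʳ v) ≡ isSuc v
  isSuc-t v with t ⟨$⟩ʳ v | transposeView (suc a) (suc b) v
  ... | _ | at-i refl   = refl
  ... | _ | at-j _ refl = refl
  ... | _ | off _ _     = refl
  -- `t` fixes 0, so conjugation by `t` carries the transposition that deletes 0 from `x` to the one
  -- that deletes 0 from `t · x`.
  same : strip (t · x) ≈ τ a b · strip x
  same = strip-unique (t · x) (τ a b · strip x) λ k → begin
    τ zero (t ⟨$⟩ʳ (x ⟨$⟩ʳ zero)) ⟨$⟩ʳ (t ⟨$⟩ʳ (x ⟨$⟩ʳ suc k))
      ≡⟨ cong (λ v → τ v (t ⟨$⟩ʳ (x ⟨$⟩ʳ zero)) ⟨$⟩ʳ (t ⟨$⟩ʳ (x ⟨$⟩ʳ suc k))) (τ-off (λ ()) (λ ())) ⟨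
    τ (t ⟨$⟩ʳ zero) (t ⟨$⟩ʳ (x ⟨$⟩ʳ zero)) ⟨$⟩ʳ (t ⟨$⟩ʳ (x ⟨$⟩ʳ suc k))
      ≡⟨ τ-conj t zero (x ⟨$⟩ʳ zero) (x ⟨$⟩ʳ suc k) ⟨
    t ⟨$⟩ʳ (τ zero (x ⟨$⟩ʳ zero) ⟨$⟩ʳ (x ⟨$⟩ʳ suc k))
      ≡⟨ cong (t ⟨$⟩ʳ_) (suc-strip x k) ⟨
    t ⟨$⟩ʳ suc (strip x ⟨$⟩ʳ k)
      ≡⟨ τ-suc a b (strip x ⟨$⟩ʳ k) ⟩
    suc (τ a b ⟨$⟩ʳ (strip x ⟨$⟩ʳ k)) ∎
    where open ≡-Reasoning
  ℓtx : ℓ (t · x) ≡ isSuc (x ⟨$⟩ʳ zero) + ℓ (τ a b · strip x)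
  ℓtx = trans (ℓ-suc (t · x))
    (cong₂ _+_ (isSuc-t (x ⟨$⟩ʳ zero)) (ℓ-cong (strip (t · x)) (τ a b · strip x) same))
  s = isSuc (x ⟨$⟩ʳ zero)
  lemma : Step (strip x) a b → Step x (suc a) (suc b)
  lemma (up e p q) = up
    (trans ℓtx (trans (cong (s +_) e) (trans (ℕ.+-suc s _) (cong suc (sym (ℓ-suc x))))))
    (p ∘ strip-suc x) (q ∘ strip-suc x)
  lemma (down e p) = down
    (trans (ℓ-suc x) (trans (cong (s +_) e) (trans (ℕ.+-suc s _) (cong suc (sym ℓtx)))))
    (λ f inv → p (f ∘ suc) (strip-invariant f x inv))

ℓ-step-≤ : ∀ (x : Perm n) {i j} → i ≢ j → ℓ (τ i j · x) ≤ suc (ℓ x)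
ℓ-step-≤ x i≢j with step x i≢j
... | up e _ _ = ℕ.≤-reflexive e
... | down e _ = ℕ.≤-trans (ℕ.n≤1+n _) (ℕ.≤-trans (ℕ.≤-reflexive (sym e)) (ℕ.n≤1+n _))

ℓ-drop : ∀ (x : Perm n) {i j} → i ≢ j → x ⟨$⟩ʳ i ≡ j → ℓ x ≡ suc (ℓ (τ i j · x))
ℓ-drop x i≢j xi≡j with step x i≢j
... | up _ xi≢j _ = contradiction xi≡j xi≢j
... | down e _    = e

ℓ-drop-label : ∀ (x : Perm n) {i j} → i ≢ j → ℓ x ≡ suc (ℓ (τ i j · x)) →
  ∀ f → Invariant f x → f i ≡ f j
ℓ-drop-label x i≢j e with step x i≢j
... | up e′ _ _ = contradiction (trans e (cong suc e′)) (ℕ.<⇒≢ (ℕ.m<n⇒m<1+n (ℕ.n<1+n _)))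
... | down _ p  = p

-- The recursive length is the transposition length.

ℓ-transposition-≤ : ∀ (t x : Perm n) → IsTransposition t → ℓ (t · x) ≤ suc (ℓ x)
ℓ-transposition-≤ t x (i , j , i≢j , t≈) = ℕ.≤-trans
  (ℕ.≤-reflexive (ℓ-cong (t · x) (τ i j · x)
    (λ k → trans (t≈ (x ⟨$⟩ʳ k)) (sym (τ-≈ i j (x ⟨$⟩ʳ k))))))
  (ℓ-step-≤ x i≢j)

ℓ-prod-≤ : ∀ {ts : List (Perm n)} (x : Perm n) → All IsTransposition ts →
  ℓ (prod ts · x) ≤ length ts + ℓ x
ℓ-prod-≤ x [] = ℕ.≤-reflexive (ℓ-cong (prod [] · x) x (λ _ → refl))
ℓ-prod-≤ {ts = t ∷ ts} x (pt ∷ pts) = ℕ.≤-trans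
  (ℕ.≤-reflexive (ℓ-cong (prod (t ∷ ts) · x) (t · (prod ts · x)) (λ _ → refl)))
  (ℕ.≤-trans (ℓ-transposition-≤ t (prod ts · x) pt) (s≤s (ℓ-prod-≤ x pts)))

ℓ-minimal : ∀ (x : Perm n) {m} → ProdOf IsTransposition m x → ℓ x ≤ m
ℓ-minimal {n} x (ts , refl , pts , eq) = ℕ.≤-trans
  (ℕ.≤-reflexive (ℓ-cong x (prod ts · id) (sym ∘ eq)))
  (ℕ.≤-trans (ℓ-prod-≤ id pts)
    (ℕ.≤-reflexive (trans (cong (length ts +_) (ℓ-id n)) (ℕ.+-identityʳ _))))

τ-transposition : ∀ {i j : Fin n} → i ≢ j → IsTransposition (τ i j)
τ-transposition {i = i} {j} i≢j = i , j , i≢j , τ-≈ i j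

lift₀-transposition : ∀ {t : Perm n} → IsTransposition t → IsTransposition (lift₀ t)
lift₀-transposition {t = t} (i , j , i≢j , t≈) = suc i , suc j , i≢j ∘ suc-injective , λ
  { zero    → sym (lift₀-transpose i j zero)
  ; (suc k) → trans (cong suc (t≈ k)) (sym (lift₀-transpose i j (suc k))) }

lift₀-all : ∀ {ts : List (Perm n)} → All IsTransposition ts → All IsTransposition (map lift₀ ts)
lift₀-all []               = []
lift₀-all {ts = t ∷ _} (pt ∷ pts) = lift₀-transposition {t = t} pt ∷ lift₀-all pts

prod-lift₀ : ∀ (ts : List (Perm n)) → prod (map lift₀ ts) ≈ lift₀ (prod ts)
prod-lift₀ []       zero    = refl
prod-lift₀ []       (suc k) = refl
prod-lift₀ (t ∷ ts) zero    = cong (lift₀ t ⟨$⟩ʳ_) (prod-lift₀ ts zero)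
prod-lift₀ (t ∷ ts) (suc k) = cong (lift₀ t ⟨$⟩ʳ_) (prod-lift₀ ts (suc k))

lift₀-strip : ∀ (x : Perm (suc n)) → τ zero (x ⟨$⟩ʳ zero) · lift₀ (strip x) ≈ x
lift₀-strip x zero    = τ-i zero (x ⟨$⟩ʳ zero)
lift₀-strip x (suc k) = trans (cong (τ zero (x ⟨$⟩ʳ zero) ⟨$⟩ʳ_) (suc-strip x k)) (τ-involutive _ _ _)

factor : ∀ (x : Perm n) → ProdOf IsTransposition (ℓ x) x
factor {zero}  x = [] , sym (ℓ-zero x) , [] , λ ()
factor {suc n} x with factor (strip x)
... | ts , len , pts , eq = go (x ⟨$⟩ʳ zero) refl
  where
  tail : ∀ v → τ zero (x ⟨$⟩ʳ zero) ⟨$⟩ʳ (prod (map lift₀ ts) ⟨$⟩ʳ v) ≡ x ⟨$⟩ʳ v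
  tail v = trans (cong (τ zero (x ⟨$⟩ʳ zero) ⟨$⟩ʳ_) (trans (prod-lift₀ ts v) (lift₀-eq v))) (lift₀-strip x v)
    where
    lift₀-eq : lift₀ (prod ts) ≈ lift₀ (strip x)
    lift₀-eq zero    = refl
    lift₀-eq (suc k) = cong suc (eq k)
  go : ∀ v → x ⟨$⟩ʳ zero ≡ v → ProdOf IsTransposition (ℓ x) x
  -- Here `τ zero zero` is the identity and not a transposition, so no factor is prepended.
  go zero x0 = map lift₀ ts , trans (length-map lift₀ ts) (trans len (sym (ℓ-fix x x0))) , lift₀-all pts ,
    λ v → trans (sym (trans (cong (λ w → τ zero w ⟨$⟩ʳ (prod (map lift₀ ts) ⟨$⟩ʳ v)) x0) (τ-diagonal zero _))) (tail v)
  go (suc c) x0 = τ zero (x ⟨$⟩ʳ zero) ∷ map lift₀ ts ,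
    trans (cong suc (trans (length-map lift₀ ts) len)) (sym (ℓ-move x x0)) ,
    τ-transposition (λ e → contradiction (trans e x0) (λ ())) ∷ lift₀-all pts , tail

ℓ₂-is-ℓ : ∀ (x : Perm n) → ℓ₂-is x (ℓ x)
ℓ₂-is-ℓ x = factor x , λ m → ℓ-minimal x

LengthIs-unique : ∀ {S : Perm n → Set} {x a b} → LengthIs S x a → LengthIs S x b → a ≡ b
LengthIs-unique (p , p-min) (q , q-min) = ℕ.≤-antisym (p-min _ q) (q-min _ p)

≤₂⇒ℓ : ∀ (x y : Perm n) → x ≤₂ y → ℓ y ≡ ℓ x + ℓ (x ⁻¹ · y)
≤₂⇒ℓ x y (a , b , c , la , lb , lc , c≡) =
  trans (LengthIs-unique {x = y} (ℓ₂-is-ℓ y) lc) (trans c≡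
    (cong₂ _+_ (LengthIs-unique {x = x} la (ℓ₂-is-ℓ x))
               (LengthIs-unique {x = x ⁻¹ · y} lb (ℓ₂-is-ℓ (x ⁻¹ · y)))))

ℓ⇒≤₂ : ∀ (x y : Perm n) → ℓ y ≡ ℓ x + ℓ (x ⁻¹ · y) → x ≤₂ y
ℓ⇒≤₂ x y eq = _ , _ , _ , ℓ₂-is-ℓ x , ℓ₂-is-ℓ (x ⁻¹ · y) , ℓ₂-is-ℓ y , eq

ℓ-·-≤ : ∀ (x y : Perm n) → ℓ (x · y) ≤ ℓ x + ℓ y
ℓ-·-≤ x y with factor x
... | ts , len , pts , eq = ℕ.≤-trans
  (ℕ.≤-reflexive (ℓ-cong (x · y) (prod ts · y) (λ k → sym (eq (y ⟨$⟩ʳ k)))))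
  (ℕ.≤-trans (ℓ-prod-≤ y pts) (ℕ.≤-reflexive (cong (_+ ℓ y) len)))

-- Descending chains in the absolute order.

-- Each link is one length-lowering transposition, so that properties of `y` pass down to `z` one
-- transposition at a time.
data _≼_ (z : Perm n) : Perm n → Set where
  done : ∀ {y} → z ≈ y → z ≼ y
  down : ∀ {w y i j} → i ≢ j → w ≈ τ i j · y → ℓ y ≡ suc (ℓ w) → z ≼ w → z ≼ y

-- The length equation leaves no slack: each factor contributes at most one to `ℓ y`, so removing it
-- must lower the length by exactly one.
prod⇒≼ : ∀ {ts : List (Perm n)} → All IsTransposition ts → ∀ y z →
  prod ts · z ≈ y → ℓ y ≡ length ts + ℓ z → z ≼ y
prod⇒≼ [] y z eq _ = done eq
prod⇒≼ {ts = t ∷ ts} (pt@(i , j , i≢j , t≈) ∷ pts) y z eq len =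
  down i≢j w≈ (trans len (cong suc (sym ℓw))) (prod⇒≼ pts w z (λ _ → refl) ℓw)
  where
  w = prod ts · z
  w≈ : w ≈ τ i j · y
  w≈ k = trans (sym (τ-involutive i j _)) (cong (τ i j ⟨$⟩ʳ_)
    (trans (τ-≈ i j _) (trans (sym (t≈ _)) (eq k))))
  ℓw : ℓ w ≡ length ts + ℓ z
  ℓw = ℕ.≤-antisym (ℓ-prod-≤ z pts) (ℕ.≤-pred (ℕ.≤-trans (ℕ.≤-reflexive (sym len))
    (ℕ.≤-trans (ℕ.≤-reflexive (ℓ-cong y (t · w) (sym ∘ eq))) (ℓ-transposition-≤ t w pt))))

-- Chains multiply on the left, whereas the complement of `x` in `y` stands on the right of `x`;
-- conjugation moves its factors across and keeps their number.
conj-factor : ∀ (x : Perm n) {ts : List (Perm n)} → All IsTransposition ts →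
  ∃[ us ] (length us ≡ length ts × All IsTransposition us × prod us · x ≈ x · prod ts)
conj-factor x [] = [] , refl , [] , λ _ → refl
conj-factor x {t ∷ ts} ((i , j , i≢j , t≈) ∷ pts) with conj-factor x pts
... | us , len , pus , eq =
  τ (x ⟨$⟩ʳ i) (x ⟨$⟩ʳ j) ∷ us , cong suc len ,
  τ-transposition (i≢j ∘ ⟨$⟩ʳ-injective x) ∷ pus , λ k →
    trans (cong (τ (x ⟨$⟩ʳ i) (x ⟨$⟩ʳ j) ⟨$⟩ʳ_) (eq k))
      (trans (sym (τ-conj x i j _)) (cong (x ⟨$⟩ʳ_) (trans (τ-≈ i j _) (sym (t≈ _)))))

≤₂⇒≼ : ∀ (x y : Perm n) → x ≤₂ y → x ≼ y
≤₂⇒≼ x y x≤y with factor (x ⁻¹ · y)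
... | ts , len , pts , eq with conj-factor x pts
...   | us , len′ , pus , eq′ = prod⇒≼ pus y x
  (λ k → trans (eq′ k) (trans (cong (x ⟨$⟩ʳ_) (eq k)) (inverseʳ x)))
  (trans (≤₂⇒ℓ x y x≤y) (trans (ℕ.+-comm (ℓ x) _) (cong (_+ ℓ x) (sym (trans len′ len)))))

-- The factors of `x` already stand to the left of the complement, so removing them leads down to
-- it.
≤₂⇒complement-≼ : ∀ (x y : Perm n) → x ≤₂ y → (x ⁻¹ · y) ≼ y
≤₂⇒complement-≼ x y x≤y with factor x
... | ts , len , pts , eq = prod⇒≼ pts y (x ⁻¹ · y)
  (λ k → trans (eq _) (inverseʳ x))
  (trans (≤₂⇒ℓ x y x≤y) (cong (_+ ℓ (x ⁻¹ · y)) (sym len)))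

-- A length-lowering transposition swaps two points of equal label, so every link keeps the
-- labelling invariant.
Invariant-≼ : ∀ (f : Fin n → Label) {y z} → z ≼ y → Invariant f y → Invariant f z
Invariant-≼ f (done z≈y) inv k = trans (cong f (z≈y k)) (inv k)
Invariant-≼ f {y} (down {w} {i = i} {j} i≢j w≈ e z≼w) inv = Invariant-≼ f z≼w λ k →
  trans (cong f (w≈ k)) (trans (τ-invariant f fi≡fj _) (inv k))
  where
  fi≡fj : f i ≡ f j
  fi≡fj = ℓ-drop-label y i≢j (trans e (cong suc (ℓ-cong w (τ i j · y) w≈))) f inv

-- Increasing cycles are inherited downwards.

-- Every label class is a union of cycles, and y maps each element to the next
-- larger one of its class or the maximum to the minimum; hence the classes are
-- exactly the cycles, written increasingly.
record Increasing (y : Perm n) : Set where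
  field
    label : Fin n → Label
    inv   : Invariant label y
    asc   : ∀ u w → label w ≡ label u → u F.< y ⟨$⟩ʳ u → u F.< w → y ⟨$⟩ʳ u F.≤ w
    desc  : ∀ u w → label w ≡ label u → y ⟨$⟩ʳ u F.≤ u → y ⟨$⟩ʳ u F.≤ w × w F.≤ u

does-≡⇒ : ∀ {A B : Set} (a? : Dec A) (b? : Dec B) → does a? ≡ does b? → A → B
does-≡⇒ (yes _) (yes b) _ _ = b
does-≡⇒ (no ¬a) _       _ a = contradiction a ¬a

-- Swapping the images of a < b splits their block into its part in ]a , b]
-- and the rest.
module Split {y y′ : Perm n} (I : Increasing y) {a b : Fin n} (a<b : a F.< b)
             (y′≈ : y′ ≈ y · τ a b)
             (fb≡fa : Increasing.label I b ≡ Increasing.label I a) where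

  open Increasing I renaming (label to f)

  -- `y′` agrees with `y` except for the exchanged images of `a` and `b`, so a property of arrows
  -- splits into three cases.
  images : (P : Fin n → Fin n → Set) → P a (y ⟨$⟩ʳ b) → P b (y ⟨$⟩ʳ a) →
    (∀ u → u ≢ a → u ≢ b → P u (y ⟨$⟩ʳ u)) → ∀ u → P u (y′ ⟨$⟩ʳ u)
  images P pa pb p u = subst (P u) (sym (y′≈ u)) (lemma (transposeView a b u))
    where
    lemma : ∀ {v} → TransposeView a b u v → P u (y ⟨$⟩ʳ v)
    lemma (at-i refl)     = pa
    lemma (at-j _ refl)   = pb
    lemma (off u≢a u≢b)   = p u u≢a u≢b

  yb≤a : y ⟨$⟩ʳ b F.≤ b → y ⟨$⟩ʳ b F.≤ a
  yb≤a yb≤b = proj₁ (desc b a (sym fb≡fa) yb≤b)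

  a<ya : a F.< y ⟨$⟩ʳ a
  a<ya with ℕ.≤-<-connex (toℕ (y ⟨$⟩ʳ a)) (toℕ a)
  ... | inj₁ ya≤a = contradiction (proj₂ (desc a b fb≡fa ya≤a)) (ℕ.<⇒≱ a<b)
  ... | inj₂ lt   = lt

  Inside : Fin n → Set
  Inside w = f w ≡ f a × a F.< w × w F.≤ b

  inside? : ∀ w → Dec (Inside w)
  inside? w = ≡-dec Bool._≟_ (f w) (f a) ×-dec (a <? w ×-dec w ≤? b)

  inside-b : Inside b
  inside-b = fb≡fa , a<b , ℕ.≤-refl

  -- From strictly between `a` and `b`, `y` moves to the next element of the class and cannot jump
  -- over `b`; and `b` now takes the image of `a`, the first element above `a`.
  Inside⇒ : ∀ u → Inside u → Inside (y′ ⟨$⟩ʳ u)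
  Inside⇒ = images (λ u v → Inside u → Inside v)
    (λ (_ , a<a , _) → contradiction a<a (ℕ.<-irrefl refl))
    (λ _ → inv a , a<ya , asc a b fb≡fa a<ya a<b)
    λ u u≢a u≢b (fu , a<u , u≤b) →
      let u<b = ℕ.≤∧≢⇒< u≤b (u≢b ∘ toℕ-injective)
          fb≡fu = trans fb≡fa (sym fu)
      in trans (inv u) fu , others u fb≡fu a<u u<b
    where
    others : ∀ u → f b ≡ f u → a F.< u → u F.< b → a F.< y ⟨$⟩ʳ u × y ⟨$⟩ʳ u F.≤ b
    others u fb≡fu a<u u<b with ℕ.≤-<-connex (toℕ (y ⟨$⟩ʳ u)) (toℕ u)
    ... | inj₁ yu≤u = contradiction (proj₂ (desc u b fb≡fu yu≤u)) (ℕ.<⇒≱ u<b)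
    ... | inj₂ u<yu = ℕ.<-trans a<u u<yu , asc u b fb≡fu u<yu u<b

  -- The arrow of `y` that entered from `a` is replaced by one to y(b), which lies beyond `b` or is
  -- at most `a`.
  Inside⇐ : ∀ u → Inside (y′ ⟨$⟩ʳ u) → Inside u
  Inside⇐ = images (λ u v → Inside v → Inside u)
    (λ (_ , a<yb , yb≤b) → contradiction (yb≤a yb≤b) (ℕ.<⇒≱ a<yb))
    (λ _ → inside-b)
    λ u u≢a u≢b (fyu , a<yu , yu≤b) →
      let fu = trans (sym (inv u)) fyu in fu , others u u≢a (sym fu) a<yu yu≤b
    where
    others : ∀ u → u ≢ a → f a ≡ f u → a F.< y ⟨$⟩ʳ u → y ⟨$⟩ʳ u F.≤ b → a F.< u × u F.≤ b
    others u u≢a fa≡fu a<yu yu≤b with ℕ.≤-<-connex (toℕ (y ⟨$⟩ʳ u)) (toℕ u)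
    ... | inj₁ yu≤u = contradiction (proj₁ (desc u a fa≡fu yu≤u)) (ℕ.<⇒≱ a<yu)
    ... | inj₂ u<yu with ℕ.≤-<-connex (toℕ u) (toℕ a)
    ...   | inj₂ a<u = a<u , ℕ.≤-trans (ℕ.<⇒≤ u<yu) yu≤b
    ...   | inj₁ u≤a = contradiction
      (asc u a fa≡fu u<yu (ℕ.≤∧≢⇒< u≤a (u≢a ∘ toℕ-injective))) (ℕ.<⇒≱ a<yu)

  f′ : Fin n → Label
  f′ w = does (inside? w) ∷ f w

  f′⇒f : ∀ w u → f′ w ≡ f′ u → f w ≡ f u
  f′⇒f w u = proj₂ ∘ ∷-injective

  f′⇒inside : ∀ w u → f′ w ≡ f′ u → Inside w → Inside u
  f′⇒inside w u = does-≡⇒ (inside? w) (inside? u) ∘ proj₁ ∘ ∷-injective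

  above-a : ∀ w → f′ w ≡ f′ a → a F.< w → b F.< w
  above-a w eq a<w with ℕ.≤-<-connex (toℕ w) (toℕ b)
  ... | inj₂ b<w = b<w
  ... | inj₁ w≤b = contradiction
    (proj₁ (proj₂ (f′⇒inside w a eq (f′⇒f w a eq , a<w , w≤b)))) (ℕ.<-irrefl refl)

  inv′ : Invariant f′ y′
  inv′ u = cong₂ _∷_
    (does-⇔ (mk⇔ (Inside⇐ u) (Inside⇒ u)) (inside? (y′ ⟨$⟩ʳ u)) (inside? u))
    (images (λ u v → f v ≡ f u) (trans (inv b) fb≡fa) (trans (inv a) (sym fb≡fa)) (λ u _ _ → inv u) u)

  -- If it ascends, `a` now maps to the next element after `b`, which is next after `a` once the
  -- interval has left its class. Nothing in the class of `b` lies above `b`.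
  asc′ : ∀ u w → f′ w ≡ f′ u → u F.< y′ ⟨$⟩ʳ u → u F.< w → y′ ⟨$⟩ʳ u F.≤ w
  asc′ u w = images (λ u v → f′ w ≡ f′ u → u F.< v → u F.< w → v F.≤ w) at-a at-b
    (λ u _ _ eq → asc u w (f′⇒f w u eq)) u
    where
    at-a : f′ w ≡ f′ a → a F.< y ⟨$⟩ʳ b → a F.< w → y ⟨$⟩ʳ b F.≤ w
    at-a eq a<yb a<w with ℕ.≤-<-connex (toℕ (y ⟨$⟩ʳ b)) (toℕ b)
    ... | inj₁ yb≤b = contradiction (yb≤a yb≤b) (ℕ.<⇒≱ a<yb)
    ... | inj₂ b<yb = asc b w (trans (f′⇒f w a eq) (sym fb≡fa)) b<yb (above-a w eq a<w)
    at-b : f′ w ≡ f′ b → b F.< y ⟨$⟩ʳ a → b F.< w → y ⟨$⟩ʳ a F.≤ w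
    at-b eq _ b<w = contradiction (proj₂ (proj₂ (f′⇒inside b w (sym eq) inside-b))) (ℕ.<⇒≱ b<w)

  -- If y(b) is at most `a`, then `b` was the old maximum and `a` takes over that role in the outer
  -- class; `b` closes the inner class at its minimum y(a).
  desc′ : ∀ u w → f′ w ≡ f′ u → y′ ⟨$⟩ʳ u F.≤ u → y′ ⟨$⟩ʳ u F.≤ w × w F.≤ u
  desc′ u w = images (λ u v → f′ w ≡ f′ u → v F.≤ u → v F.≤ w × w F.≤ u) at-a at-b
    (λ u _ _ eq → desc u w (f′⇒f w u eq)) u
    where
    at-a : f′ w ≡ f′ a → y ⟨$⟩ʳ b F.≤ a → y ⟨$⟩ʳ b F.≤ w × w F.≤ a
    at-a eq yb≤a′ with desc b w (trans (f′⇒f w a eq) (sym fb≡fa)) (ℕ.≤-trans yb≤a′ (ℕ.<⇒≤ a<b))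
    ... | yb≤w , w≤b = yb≤w , ℕ.≮⇒≥ (λ a<w → ℕ.<⇒≱ (above-a w eq a<w) w≤b)
    at-b : f′ w ≡ f′ b → y ⟨$⟩ʳ a F.≤ b → y ⟨$⟩ʳ a F.≤ w × w F.≤ b
    at-b eq _ with f′⇒inside b w (sym eq) inside-b
    ... | fw , a<w , w≤b = asc a w fw a<ya a<w , w≤b

  increasing : Increasing y′
  increasing = record { label = f′ ; inv = inv′ ; asc = asc′ ; desc = desc′ }

-- `Split` exchanges images, so the left factor `τ i j` is read as a right factor on the preimages
-- `a` and `b`. Their labels agree because the length drops.
Increasing-drop : ∀ {y y′ : Perm n} {i j} → i ≢ j → y′ ≈ τ i j · y →
  ℓ y ≡ suc (ℓ (τ i j · y)) → Increasing y → Increasing y′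
Increasing-drop {y = y} {y′} {i} {j} i≢j y′≈ e I = go (ℕ.<-cmp (toℕ a) (toℕ b))
  where
  open Increasing I
  a = y ⟨$⟩ˡ i
  b = y ⟨$⟩ˡ j
  labels : label b ≡ label a
  labels = trans (sym (inv b)) (trans (cong label (inverseʳ y))
    (trans (sym (ℓ-drop-label y i≢j e label inv)) (trans (cong label (sym (inverseʳ y))) (inv a))))
  y′≈ab : y′ ≈ y · τ a b
  y′≈ab k = trans (y′≈ k) (sym (trans (τ-conj y a b k)
    (cong₂ (λ p q → τ p q ⟨$⟩ʳ (y ⟨$⟩ʳ k)) (inverseʳ y) (inverseʳ y))))
  go : Tri (a F.< b) (toℕ a ≡ toℕ b) (b F.< a) → Increasing y′
  go (tri< a<b _ _) = Split.increasing I a<b y′≈ab labels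
  go (tri> _ _ b<a) = Split.increasing I b<a
    (λ k → trans (y′≈ab k) (cong (y ⟨$⟩ʳ_) (τ-sym a b k))) (sym labels)
  go (tri≈ _ a≡b _) = contradiction
    (trans (sym (inverseʳ y)) (trans (cong (y ⟨$⟩ʳ_) (toℕ-injective a≡b)) (inverseʳ y))) i≢j

Increasing-≼ : ∀ {y z : Perm n} → z ≼ y → Increasing y → Increasing z
Increasing-≼ {y = y} {z} (done z≈y) I = record
  { label = label
  ; inv   = λ k → trans (cong label (z≈y k)) (inv k)
  ; asc   = λ u w → subst (λ v → label w ≡ label u → u F.< v → u F.< w → v F.≤ w) (sym (z≈y u)) (asc u w)
  ; desc  = λ u w → subst (λ v → label w ≡ label u → v F.≤ u → v F.≤ w × w F.≤ u) (sym (z≈y u)) (desc u w)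
  }
  where open Increasing I
Increasing-≼ {y = y} (down {w} {i = i} {j} i≢j w≈ e z≼w) I =
  Increasing-≼ z≼w (Increasing-drop i≢j w≈ (trans e (cong suc (ℓ-cong w (τ i j · y) w≈))) I)

-- The long cycle.

cyc-view : ∀ (u : Fin (suc n)) → toℕ (cyc u) ≡ suc (toℕ u) ⊎ (cyc u ≡ zero × toℕ u ≡ n)
cyc-view {zero}  zero = inj₂ (refl , refl)
cyc-view {suc n} zero = inj₁ refl
cyc-view {suc n} (suc u) with cyc {n} u | cyc-view {n} u
... | zero  | inj₂ (_ , eq) = inj₂ (refl , cong suc eq)
... | suc v | inj₁ eq       = inj₁ (cong suc eq)

longCycle-increasing : ∀ n → Increasing (longCycle n)
longCycle-increasing zero = record
  { label = λ () ; inv = λ () ; asc = λ () ; desc = λ () }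
longCycle-increasing (suc n) = record
  { label = λ _ → []
  ; inv   = λ _ → refl
  ; asc   = λ u w _ → asc u w
  ; desc  = λ u w _ → desc u w
  }
  where
  asc : ∀ (u w : Fin (suc n)) → u F.< cyc u → u F.< w → cyc u F.≤ w
  asc u w _ u<w with cyc-view u
  ... | inj₁ eq       = ℕ.≤-trans (ℕ.≤-reflexive eq) u<w
  ... | inj₂ (eq , _) = ℕ.≤-trans (ℕ.≤-reflexive (cong toℕ eq)) z≤n
  desc : ∀ (u w : Fin (suc n)) → cyc u F.≤ u → cyc u F.≤ w × w F.≤ u
  desc u w cu≤u with cyc-view u
  ... | inj₁ eq        = contradiction (ℕ.≤-reflexive (sym eq)) (ℕ.≤⇒≯ cu≤u)
  ... | inj₂ (eq , eq′) = ℕ.≤-trans (ℕ.≤-reflexive (cong toℕ eq)) z≤n ,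
    ℕ.≤-trans (toℕ≤pred[n] w) (ℕ.≤-reflexive (sym eq′))

-- Parity of gaps.

even : ℕ → Bool
even zero    = true
even (suc m) = not (even m)

even-2*+ : ∀ k m → even (2 * k + m) ≡ even m
even-2*+ zero    m = refl
even-2*+ (suc k) m = trans (cong (λ v → even (v + m)) (ℕ.*-suc 2 k))
  (trans (Bool.not-involutive _) (even-2*+ k m))

even-odd∸ : ∀ {a b} → a < b → Odd (b ∸ a) → even b ≡ not (even a)
even-odd∸ {a} {b} a<b (k , eq) =
  trans (cong even (trans (sym (ℕ.m∸n+n≡m (ℕ.<⇒≤ a<b))) (cong (_+ a) eq)))
        (cong not (even-2*+ k a))

-- The second clause stands for odd cycle length: an even number of odd gaps makes the minimum and
-- the maximum of a cycle agree in parity.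
OddGaps : Perm n → Set
OddGaps z = ∀ u →
  (u F.< z ⟨$⟩ʳ u → even (toℕ (z ⟨$⟩ʳ u)) ≡ not (even (toℕ u))) ×
  (z ⟨$⟩ʳ u F.≤ u → even (toℕ (z ⟨$⟩ʳ u)) ≡ even (toℕ u))

iter-suc : ∀ (x : Perm n) k i → iter x (suc k) i ≡ iter x k (x ⟨$⟩ʳ i)
iter-suc x zero    i = refl
iter-suc x (suc k) i = cong (x ⟨$⟩ʳ_) (iter-suc x k i)

iter-invariant : ∀ (x : Perm n) f → Invariant f x → ∀ k i → f (iter x k i) ≡ f i
iter-invariant x f inv zero    i = refl
iter-invariant x f inv (suc k) i = trans (inv _) (iter-invariant x f inv k i)

-- The bound on earlier iterates later shows that the cycle does not close before step `m`; the
-- parity clause counts one flip per ascent.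
Climbs : Perm n → Fin n → ℕ → Set
Climbs x v m =
  x ⟨$⟩ʳ iter x m v F.≤ iter x m v × v F.≤ iter x m v ×
  (∀ j → j < m → iter x j v F.< iter x m v) ×
  even (toℕ (iter x m v)) ≡ even (m + toℕ v)

-- Starting at v, iterate x while it ascends: n ∸ v steps suffice.
climb : ∀ (x : Perm n) →
  (∀ i → i F.< x ⟨$⟩ʳ i → even (toℕ (x ⟨$⟩ʳ i)) ≡ not (even (toℕ i))) →
  ∀ fuel v → n ≤ toℕ v + fuel → ∃[ m ] Climbs x v m
climb x gap zero v le = contradiction (ℕ.≤-trans le (ℕ.≤-reflexive (ℕ.+-identityʳ _))) (ℕ.<⇒≱ (toℕ<n v))
climb x gap (suc fuel) v le with ℕ.≤-<-connex (toℕ (x ⟨$⟩ʳ v)) (toℕ v)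
... | inj₁ xv≤v = 0 , xv≤v , ℕ.≤-refl , (λ j ()) , refl
... | inj₂ v<xv with climb x gap fuel (x ⟨$⟩ʳ v)
    (ℕ.≤-trans le (ℕ.≤-trans (ℕ.≤-reflexive (ℕ.+-suc _ fuel)) (ℕ.+-monoˡ-≤ fuel v<xv)))
...   | m , top , above , below , par = suc m , subst Top (sym (iter-suc x m v)) top-result
  where
  Top : Fin _ → Set
  Top w = x ⟨$⟩ʳ w F.≤ w × v F.≤ w × (∀ j → j < suc m → iter x j v F.< w) ×
          even (toℕ w) ≡ even (suc m + toℕ v)
  w = iter x m (x ⟨$⟩ʳ v)
  earlier : ∀ j → j < suc m → iter x j v F.< w
  earlier zero    _         = ℕ.<-≤-trans v<xv above
  earlier (suc j) (s≤s j<m) = subst (F._< w) (sym (iter-suc x j v)) (below j j<m)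
  parity : even (toℕ w) ≡ even (suc m + toℕ v)
  parity = trans par (trans (even-cong m (gap v v<xv)) (cong even (ℕ.+-suc m (toℕ v))))
    where
    even-cong : ∀ m {a b} → even a ≡ not (even b) → even (m + a) ≡ even (m + suc b)
    even-cong zero    eq = eq
    even-cong (suc m) eq = cong not (even-cong m eq)
  top-result : Top w
  top-result = top , ℕ.≤-trans (ℕ.<⇒≤ v<xv) above , earlier , parity

ONC⇒Increasing : ∀ (x : Perm n) → ONC x → Increasing x
ONC⇒Increasing {n} x (nc , _) = Increasing-≼ (≤₂⇒≼ x (longCycle n) nc) (longCycle-increasing n)

-- At a descent `u` the image is the minimum of the cycle. The climb from there ends at `u` after
-- `m` ascents, so the cycle has length `suc m`, and its oddness makes the number of parity flips
-- even.
ONC⇒OddGaps : ∀ (x : Perm n) → ONC x → OddGaps x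
ONC⇒OddGaps {n} x onc@(_ , odd , gaps) u = gap u , desc-even
  where
  open Increasing (ONC⇒Increasing x onc)
  gap : ∀ i → i F.< x ⟨$⟩ʳ i → even (toℕ (x ⟨$⟩ʳ i)) ≡ not (even (toℕ i))
  gap i i<xi = even-odd∸ i<xi (gaps i i<xi)
  desc-even : x ⟨$⟩ʳ u F.≤ u → even (toℕ (x ⟨$⟩ʳ u)) ≡ even (toℕ u)
  desc-even xu≤u with climb x gap n (x ⟨$⟩ʳ u) (ℕ.m≤n+m n _)
  ... | m , top , _ , below , par = result (odd u (suc m) cycleLength)
    where
    w = iter x m (x ⟨$⟩ʳ u)
    labels : label w ≡ label u
    labels = trans (iter-invariant x label inv m _) (inv u)
    -- Neither `u` nor `w` ascends and they share a class, so both are its maximum.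
    w≡u : w ≡ u
    w≡u = toℕ-injective (ℕ.≤-antisym (proj₂ (desc u w labels xu≤u)) (proj₂ (desc w u (sym labels) top)))
    return : ∀ m′ → 1 ≤ m′ → m′ < suc m → iter x m′ u ≢ u
    return (suc m′) _ (s≤s m′<m) eq = ℕ.<-irrefl
      (cong toℕ (trans (sym (iter-suc x m′ u)) (trans eq (sym w≡u)))) (below m′ m′<m)
    cycleLength : CycleLength x u (suc m)
    cycleLength = s≤s z≤n , trans (iter-suc x m u) w≡u , return
    result : Odd (suc m) → even (toℕ (x ⟨$⟩ʳ u)) ≡ even (toℕ u)
    result (k , eq) = sym (trans (cong (even ∘ toℕ) (sym w≡u)) (trans par
      (trans (cong (λ q → even (q + _)) (ℕ.suc-injective eq)) (even-2*+ k _))))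

-- If u < z(u), then `y` ascends at `u` to at most z(u), so `y` flips the parity and `x` at z(u)
-- keeps it. Otherwise `x` at z(u) and `y` at `u` both ascend or both do not, and the flips cancel.
complement-OddGaps : ∀ (x y : Perm n) → (I : Increasing y) → Invariant (Increasing.label I) (x ⁻¹ · y) →
  OddGaps x → OddGaps y → OddGaps (x ⁻¹ · y)
complement-OddGaps x y I zinv gx gy u = up-case , down-case
  where
  open Increasing I
  z = x ⁻¹ · y
  xzu : x ⟨$⟩ʳ (z ⟨$⟩ʳ u) ≡ y ⟨$⟩ʳ u
  xzu = inverseʳ x
  gxz : (z ⟨$⟩ʳ u F.< y ⟨$⟩ʳ u → even (toℕ (y ⟨$⟩ʳ u)) ≡ not (even (toℕ (z ⟨$⟩ʳ u)))) ×
        (y ⟨$⟩ʳ u F.≤ z ⟨$⟩ʳ u → even (toℕ (y ⟨$⟩ʳ u)) ≡ even (toℕ (z ⟨$⟩ʳ u)))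
  gxz = subst (λ v → (z ⟨$⟩ʳ u F.< v → even (toℕ v) ≡ not (even (toℕ (z ⟨$⟩ʳ u)))) ×
                     (v F.≤ z ⟨$⟩ʳ u → even (toℕ v) ≡ even (toℕ (z ⟨$⟩ʳ u)))) xzu (gx (z ⟨$⟩ʳ u))
  up-case : u F.< z ⟨$⟩ʳ u → even (toℕ (z ⟨$⟩ʳ u)) ≡ not (even (toℕ u))
  up-case u<zu with ℕ.≤-<-connex (toℕ (y ⟨$⟩ʳ u)) (toℕ u)
  ... | inj₁ yu≤u = contradiction (proj₂ (desc u _ (zinv u) yu≤u)) (ℕ.<⇒≱ u<zu)
  ... | inj₂ u<yu = trans (sym (proj₂ gxz (asc u _ (zinv u) u<yu u<zu))) (proj₁ (gy u) u<yu)
  down-case : z ⟨$⟩ʳ u F.≤ u → even (toℕ (z ⟨$⟩ʳ u)) ≡ even (toℕ u)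
  down-case zu≤u with ℕ.≤-<-connex (toℕ (y ⟨$⟩ʳ u)) (toℕ u)
  ... | inj₁ yu≤u = trans (sym (proj₂ gxz (proj₁ (desc u _ (zinv u) yu≤u)))) (proj₂ (gy u) yu≤u)
  ... | inj₂ u<yu = Bool.not-injective
    (trans (sym (proj₁ gxz (ℕ.≤-<-trans zu≤u u<yu))) (proj₁ (gy u) u<yu))

-- Peeling off 3-cycles.

ττ-threeCycle : ∀ {u j k : Fin n} → u ≢ j → j ≢ k → u ≢ k → IsThreeCycle (τ u j · τ j k)
ττ-threeCycle {u = u} {j} {k} u≢j j≢k u≢k = u , j , k , u≢j , j≢k , u≢k ,
  trans (cong (τ u j ⟨$⟩ʳ_) (τ-off u≢j u≢k)) (τ-i u j) ,
  trans (cong (τ u j ⟨$⟩ʳ_) (τ-i j k)) (τ-off (u≢k ∘ sym) (j≢k ∘ sym)) ,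
  trans (cong (τ u j ⟨$⟩ʳ_) (τ-j j k)) (τ-j u j) ,
  λ l l≢u l≢j l≢k → trans (cong (τ u j ⟨$⟩ʳ_) (τ-off l≢j l≢k)) (τ-off l≢u l≢j)

ThreeCycleStep : Perm n → Set
ThreeCycleStep {n} z = Σ (Perm n) λ t → Σ (Perm n) λ z′ → IsThreeCycle t × t · z′ ≈ z ×
  ℓ z ≡ 2 + ℓ z′ × Increasing z′ × OddGaps z′

-- As the least moved point, `u` is the minimum of its cycle and its predecessor `w` the maximum.
-- Removing `u` and `j` makes `w` map straight to `k`.
threeCycleStep : ∀ (z : Perm n) → Increasing z → OddGaps z → ∀ u → z ⟨$⟩ʳ u ≢ u →
  (∀ v → v F.< u → z ⟨$⟩ʳ v ≡ v) → ThreeCycleStep z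
threeCycleStep {n} z I g u zu≢u least =
  τ u j · τ j k , z₂ , ττ-threeCycle u≢j j≢k u≢k ,
  (λ v → trans (cong (τ u j ⟨$⟩ʳ_) (τ-involutive j k _)) (τ-involutive u j _)) ,
  trans ℓz (cong suc ℓz₁) ,
  Increasing-drop {y = z₁} {z₂} j≢k (λ _ → refl) ℓz₁ (Increasing-drop {y = z} {z₁} u≢j (λ _ → refl) ℓz I) ,
  gaps
  where
  open Increasing I
  w j k : Fin n
  w = z ⟨$⟩ˡ u
  j = z ⟨$⟩ʳ u
  k = z ⟨$⟩ʳ j

  zw : z ⟨$⟩ʳ w ≡ u
  zw = inverseʳ z

  w≢u : w ≢ u
  w≢u eq = zu≢u (trans (cong (z ⟨$⟩ʳ_) (sym eq)) zw)

  u<w : u F.< w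
  u<w = ℕ.≤∧≢⇒< (ℕ.≮⇒≥ (λ w<u → w≢u (trans (sym (least w w<u)) zw))) (w≢u ∘ sym ∘ toℕ-injective)

  lw : label w ≡ label u
  lw = trans (sym (inv w)) (cong label zw)

  zw≤w : z ⟨$⟩ʳ w F.≤ w
  zw≤w = ℕ.≤-trans (ℕ.≤-reflexive (cong toℕ zw)) (ℕ.<⇒≤ u<w)

  u<j : u F.< j
  u<j with ℕ.≤-<-connex (toℕ j) (toℕ u)
  ... | inj₁ j≤u = contradiction (proj₂ (desc u w lw j≤u)) (ℕ.<⇒≱ u<w)
  ... | inj₂ lt  = lt

  lj : label j ≡ label w
  lj = trans (inv u) (sym lw)

  j-odd : even (toℕ j) ≡ not (even (toℕ u))
  j-odd = proj₁ (g u) u<j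

  j<k : j F.< k
  j<k with ℕ.≤-<-connex (toℕ k) (toℕ j)
  ... | inj₂ lt  = lt
  -- Otherwise `j` would be the maximum `w` and `k` would be `u`: a 2-cycle, whose return step keeps
  -- the parity that its ascent flips.
  ... | inj₁ k≤j = contradiction
    (trans (sym (trans (sym (proj₂ (g j) k≤j)) (cong (even ∘ toℕ) k≡u))) j-odd)
    (Bool.not-¬ refl)
    where
    j≡w : j ≡ w
    j≡w = toℕ-injective (ℕ.≤-antisym (proj₂ (desc w j lj zw≤w)) (proj₂ (desc j w (sym lj) k≤j)))
    k≡u : k ≡ u
    k≡u = trans (cong (z ⟨$⟩ʳ_) j≡w) zw

  u≢j : u ≢ j
  u≢j eq = ℕ.<⇒≢ u<j (cong toℕ eq)
  j≢k : j ≢ k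
  j≢k eq = ℕ.<⇒≢ j<k (cong toℕ eq)
  u≢k : u ≢ k
  u≢k eq = ℕ.<⇒≢ (ℕ.<-trans u<j j<k) (cong toℕ eq)

  z₁ z₂ : Perm n
  z₁ = τ u j · z
  z₂ = τ j k · z₁

  ℓz : ℓ z ≡ suc (ℓ z₁)
  ℓz = ℓ-drop z u≢j refl
  ℓz₁ : ℓ z₁ ≡ suc (ℓ z₂)
  ℓz₁ = ℓ-drop z₁ j≢k (τ-off (u≢k ∘ sym) (j≢k ∘ sym))

  Gap : Fin n → Fin n → Set
  Gap i v = (i F.< v → even (toℕ v) ≡ not (even (toℕ i))) × (v F.≤ i → even (toℕ v) ≡ even (toℕ i))

  fixed : ∀ i → Gap i i
  fixed i = (λ i<i → contradiction i<i (ℕ.<-irrefl refl)) , λ _ → refl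

  k≤w : k F.≤ w
  k≤w = proj₂ (desc w k (trans (inv j) lj) zw≤w)

  -- Two odd gaps lead from `u` to `k`, and `w` has the parity of `u`, so the new step from `w` to
  -- `k` obeys the rule.
  k-even : even (toℕ k) ≡ even (toℕ w)
  k-even = begin
    even (toℕ k)              ≡⟨ proj₁ (g j) j<k ⟩
    not (even (toℕ j))        ≡⟨ cong not j-odd ⟩
    not (not (even (toℕ u)))  ≡⟨ Bool.not-involutive _ ⟩
    even (toℕ u)              ≡⟨ cong (even ∘ toℕ) zw ⟨
    even (toℕ (z ⟨$⟩ʳ w))     ≡⟨ proj₂ (g w) zw≤w ⟩
    even (toℕ w)              ∎
    where open ≡-Reasoning

  gaps : OddGaps z₂
  -- Only `u`, `j` and `w` get new images: the first two become fixed and `w` maps to `k`.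
  gaps i with i ≟ u
  ... | yes refl = subst (Gap u) (sym (trans (cong (τ j k ⟨$⟩ʳ_) (τ-j u j)) (τ-off u≢j u≢k))) (fixed u)
  ... | no i≢u with i ≟ j
  ...   | yes refl = subst (Gap j)
      (sym (trans (cong (τ j k ⟨$⟩ʳ_) (τ-off (u≢k ∘ sym) (j≢k ∘ sym))) (τ-j j k))) (fixed j)
  ...   | no i≢j with i ≟ w
  ...     | yes refl = subst (Gap w)
      (sym (trans (cong (τ j k ⟨$⟩ʳ_) (trans (cong (τ u j ⟨$⟩ʳ_) zw) (τ-i u j))) (τ-i j k)))
      ((λ w<k → contradiction k≤w (ℕ.<⇒≱ w<k)) , λ _ → k-even)
  ...     | no i≢w = subst (Gap i)
      (sym (trans (cong (τ j k ⟨$⟩ʳ_) (τ-off zi≢u zi≢j)) (τ-off zi≢j zi≢k))) (g i)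
    where
    zi≢u : z ⟨$⟩ʳ i ≢ u
    zi≢u eq = i≢w (⟨$⟩ʳ-injective z (trans eq (sym zw)))
    zi≢j : z ⟨$⟩ʳ i ≢ j
    zi≢j eq = i≢u (⟨$⟩ʳ-injective z eq)
    zi≢k : z ⟨$⟩ʳ i ≢ k
    zi≢k eq = i≢j (⟨$⟩ʳ-injective z eq)

-- Each 3-cycle removed lowers `ℓ` by two, so a bound on `ℓ z` serves as fuel.
threeCycleFactor : ∀ fuel (z : Perm n) → ℓ z ≤ fuel → Increasing z → OddGaps z →
  ∃[ m ] (ℓ z ≡ 2 * m × ProdOf IsThreeCycle m z)
threeCycleFactor {n} fuel z le I g with all? (λ v → z ⟨$⟩ʳ v ≟ v)
... | yes fix = 0 , trans (ℓ-cong z id fix) (ℓ-id n) , [] , refl , [] , sym ∘ fix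
... | no ¬fix with ¬∀⟶∃¬-smallest n _ (λ v → z ⟨$⟩ʳ v ≟ v) ¬fix
...   | u , zu≢u , least = go fuel le (threeCycleStep z I g u zu≢u least′)
  where
  least′ : ∀ v → v F.< u → z ⟨$⟩ʳ v ≡ v
  least′ v v<u = subst (λ q → z ⟨$⟩ʳ q ≡ q)
    (toℕ-injective (trans (toℕ-inject (F.fromℕ< v<u)) (toℕ-fromℕ< v<u))) (least (F.fromℕ< v<u))
  go : ∀ fuel → ℓ z ≤ fuel → ThreeCycleStep z → ∃[ m ] (ℓ z ≡ 2 * m × ProdOf IsThreeCycle m z)
  go zero le (_ , _ , _ , _ , ℓz , _) = contradiction (ℕ.≤-trans (ℕ.≤-reflexive (sym ℓz)) le) λ ()
  go (suc fuel) le (t , z′ , pt , eq , ℓz , I′ , g′)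
    with threeCycleFactor fuel z′ (ℕ.≤-pred (ℕ.≤-trans (ℕ.n≤1+n _) (ℕ.≤-trans (ℕ.≤-reflexive (sym ℓz)) le))) I′ g′
  ... | m , ℓz′ , ts , len , pts , eq′ =
    suc m , trans ℓz (trans (cong (2 +_) ℓz′) (sym (ℕ.*-suc 2 m))) ,
    t ∷ ts , cong suc len , pt ∷ pts , λ v → trans (cong (t ⟨$⟩ʳ_) (eq′ v)) (eq v)

-- Lower bound for the number of 3-cycles.

threeCycle-≈ : ∀ {t : Perm n} ((i , j , k , _) : IsThreeCycle t) → t ≈ τ i j · τ j k
threeCycle-≈ (i , j , k , i≢j , j≢k , i≢k , ti , tj , tk , fix) l with l ≟ i
... | yes refl = trans ti (sym (trans (cong (τ i j ⟨$⟩ʳ_) (τ-off i≢j i≢k)) (τ-i i j)))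
... | no l≢i with l ≟ j
...   | yes refl = trans tj (sym (trans (cong (τ i j ⟨$⟩ʳ_) (τ-i j k)) (τ-off (i≢k ∘ sym) (j≢k ∘ sym))))
...   | no l≢j with l ≟ k
...     | yes refl = trans tk (sym (trans (cong (τ i j ⟨$⟩ʳ_) (τ-j j k)) (τ-j i j)))
...     | no l≢k   = trans (fix l l≢i l≢j l≢k)
    (sym (trans (cong (τ i j ⟨$⟩ʳ_) (τ-off l≢j l≢k)) (τ-off l≢i l≢j)))

ℓ-threeCycle-≤ : ∀ (t x : Perm n) → IsThreeCycle t → ℓ (t · x) ≤ 2 + ℓ x
ℓ-threeCycle-≤ t x p@(i , j , k , i≢j , j≢k , _) = begin
  ℓ (t · x)               ≡⟨ ℓ-cong (t · x) (τ i j · (τ j k · x)) (λ l → threeCycle-≈ {t = t} p (x ⟨$⟩ʳ l)) ⟩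
  ℓ (τ i j · (τ j k · x)) ≤⟨ ℓ-step-≤ (τ j k · x) i≢j ⟩
  suc (ℓ (τ j k · x))     ≤⟨ s≤s (ℓ-step-≤ x j≢k) ⟩
  2 + ℓ x                 ∎
  where open ℕ.≤-Reasoning

ℓ-prod-threeCycles-≤ : ∀ {ts : List (Perm n)} → All IsThreeCycle ts → ℓ (prod ts) ≤ 2 * length ts
ℓ-prod-threeCycles-≤ {n} [] = ℕ.≤-reflexive (ℓ-id n)
ℓ-prod-threeCycles-≤ {ts = t ∷ ts} (pt ∷ pts) = begin
  ℓ (t · prod ts)      ≤⟨ ℓ-threeCycle-≤ t (prod ts) pt ⟩
  2 + ℓ (prod ts)      ≤⟨ ℕ.+-monoʳ-≤ 2 (ℓ-prod-threeCycles-≤ pts) ⟩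
  2 + 2 * length ts    ≡⟨ ℕ.*-suc 2 (length ts) ⟨
  2 * suc (length ts)  ∎
  where open ℕ.≤-Reasoning

ℓ-≤-2* : ∀ (x : Perm n) {m} → ProdOf IsThreeCycle m x → ℓ x ≤ 2 * m
ℓ-≤-2* x (ts , refl , pts , eq) =
  ℕ.≤-trans (ℕ.≤-reflexive (ℓ-cong x (prod ts) (sym ∘ eq))) (ℓ-prod-threeCycles-≤ pts)

-- Comparison of the two orders.

-- Peeling attains the lower bound: any product of `k` 3-cycles has `ℓ` at most `2 * k`.
oddGaps-ℓ₃ : ∀ (x : Perm n) → Increasing x → OddGaps x → ∃[ m ] (ℓ x ≡ 2 * m × ℓ₃-is x m)
oddGaps-ℓ₃ x I g =
  let m , ℓx , p = threeCycleFactor (ℓ x) x ℕ.≤-refl I g in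
  m , ℓx , p , λ k q → ℕ.*-cancelˡ-≤ 2 (ℕ.≤-trans (ℕ.≤-reflexive (sym ℓx)) (ℓ-≤-2* x q))

ONC-ℓ₃ : ∀ (x : Perm n) → ONC x → ∃[ m ] (ℓ x ≡ 2 * m × ℓ₃-is x m)
ONC-ℓ₃ x onc = oddGaps-ℓ₃ x (ONC⇒Increasing x onc) (ONC⇒OddGaps x onc)

ONC⇒InAlt : ∀ (x : Perm n) → ONC x → InAlt x
ONC⇒InAlt x onc = let m , ℓx , _ = ONC-ℓ₃ x onc in
  m , subst (λ k → ProdOf IsTransposition k x) ℓx (factor x)

ONC-ℓ₂ : ∀ (x : Perm n) m → ONC x → ℓ₃-is x m → ℓ x ≡ 2 * m
ONC-ℓ₂ x m onc lm = let m′ , ℓx , lm′ = ONC-ℓ₃ x onc in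
  trans ℓx (cong (2 *_) (LengthIs-unique {x = x} lm′ lm))

-- For `x` and `y` the length `ℓ` is exactly twice the 3-cycle length; for the complement it is at
-- most `2 * b`, and the triangle inequality for `ℓ` gives the reverse estimate.
≤₃⇒≤₂ : ∀ (x y : Perm n) → ONC x → ONC y → x ≤₃ y → x ≤₂ y
≤₃⇒≤₂ x y ox oy (a , b , c , la , lb , lc , c≡a+b) = ℓ⇒≤₂ x y (ℕ.≤-antisym triangle (begin
  ℓ x + ℓ (x ⁻¹ · y)  ≤⟨ ℕ.+-monoʳ-≤ (ℓ x) (ℓ-≤-2* (x ⁻¹ · y) (proj₁ lb)) ⟩
  ℓ x + 2 * b         ≡⟨ cong (_+ 2 * b) (ONC-ℓ₂ x a ox la) ⟩
  2 * a + 2 * b       ≡⟨ ℕ.*-distribˡ-+ 2 a b ⟨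
  2 * (a + b)         ≡⟨ cong (2 *_) c≡a+b ⟨
  2 * c               ≡⟨ ONC-ℓ₂ y c oy lc ⟨
  ℓ y                 ∎))
  where
  open ℕ.≤-Reasoning
  triangle : ℓ y ≤ ℓ x + ℓ (x ⁻¹ · y)
  triangle = ℕ.≤-trans (ℕ.≤-reflexive (ℓ-cong y (x · (x ⁻¹ · y)) (λ _ → sym (inverseʳ x))))
    (ℓ-·-≤ x (x ⁻¹ · y))

-- The complement is increasing and obeys the parity rule, so `ℓ` is twice the 3-cycle length for
-- all three permutations and the additivity of `ℓ` can be halved.
≤₂⇒≤₃ : ∀ (x y : Perm n) → ONC x → ONC y → x ≤₂ y → x ≤₃ y
≤₂⇒≤₃ x y ox oy x≤y =
  let a , ℓx , la = ONC-ℓ₃ x ox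
      b , ℓz , lb = oddGaps-ℓ₃ (x ⁻¹ · y) Iz gz
      c , ℓy , lc = ONC-ℓ₃ y oy
  in a , b , c , la , lb , lc , halve a b c ℓx ℓz ℓy
  where
  Iy : Increasing y
  Iy = ONC⇒Increasing y oy
  z≼y : (x ⁻¹ · y) ≼ y
  z≼y = ≤₂⇒complement-≼ x y x≤y
  Iz : Increasing (x ⁻¹ · y)
  Iz = Increasing-≼ z≼y Iy
  gz : OddGaps (x ⁻¹ · y)
  gz = complement-OddGaps x y Iy (Invariant-≼ (Increasing.label Iy) z≼y (Increasing.inv Iy))
    (ONC⇒OddGaps x ox) (ONC⇒OddGaps y oy)
  halve : ∀ a b c → ℓ x ≡ 2 * a → ℓ (x ⁻¹ · y) ≡ 2 * b → ℓ y ≡ 2 * c → c ≡ a + b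
  halve a b c ℓx ℓz ℓy = ℕ.*-cancelˡ-≡ c (a + b) 2 (begin
    2 * c               ≡⟨ ℓy ⟨
    ℓ y                 ≡⟨ ≤₂⇒ℓ x y x≤y ⟩
    ℓ x + ℓ (x ⁻¹ · y)  ≡⟨ cong₂ _+_ ℓx ℓz ⟩
    2 * a + 2 * b       ≡⟨ ℕ.*-distribˡ-+ 2 a b ⟨
    2 * (a + b)         ∎)
    where open ≡-Reasoning

theorem4p9 : ∀ (N : ℕ) → 3 ≤ N →
    (∀ (x : Perm N) → ONC x → InAlt x)
    × (∀ (x y : Perm N) → ONC x → ONC y → (x ≤₃ y) ⇔ (x ≤₂ y))
theorem4p9 N _ = ONC⇒InAlt , λ x y ox oy → mk⇔ (≤₃⇒≤₂ x y ox oy) (≤₂⇒≤₃ x y ox oy)
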